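{- No quiver in the mutation class of $E_7^{(1,1)}$ has an admissible vector.
   Context: $E_7^{(1,1)}$ is the exceptional mutation-finite quiver (in the classification of Felikson–Shapiro–Tumarkin / Derksen–Owen) given by: vertices $a,b$ with a double arrow $a\Rightarrow b$; three vertices $x_1,x_2,x_3$, each with arrows $b\to x_i$ and $x_i\to a$; and pendant paths (single arrows, any orientation) attached at the $x_i$ so that the three "legs" starting at $x_1,x_2,x_3$ have $3,1,3$ vertices respectively (9 vertices in total). Quivers have no loops/2-cycles; $b_{ij}$ is the number of arrows $v_i\to v_j$ (negative if reversed); mutation $\mu_k$: $b'_{ij}=-b_{ij}$ if $k\in\{i,j\}$, else $b'_{ij}=b_{ij}+\mathrm{sgn}(b_{ik})[b_{ik}b_{kj}]_+$. For a quiver $Q$ on mutable vertices $v_1,\dots,v_n$ and $\boldsymbol b\in\mathbb Z^n$, add a frozen vertex $q$ with $b_i$ arrows from $v_i$ to $q$; mutations only at mutable vertices. $\boldsymbol b$ is admissible if $\boldsymbol b\neq0$ and the resulting quiver with frozen vertex has finite mutation class. -}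

module Defs where

open import Data.Nat using (ℕ; zero; suc)
import Data.Nat
import Data.Nat.Properties
import Data.Fin
import Data.Bool
import Data.Integer
import Data.Product
open import Data.Integer using (ℤ; +_; -_; _+_; _*_; _⊔_; _<_; _≤_; _>_)
open import Data.Integer.Properties using (<-cmp)
open import Data.Fin using (Fin; zero; suc; _≟_)
open import Data.Bool using (Bool; true; false; if_then_else_; _∨_)
open import Data.List using (List; []; _∷_; map; foldr)
open import Data.List.Relation.Unary.Any using (Any)
open import Data.Product using (_×_; _,_; ∃)
open import Relation.Nullary using (does; ¬_)
open import Relation.Binary using (tri<; tri≈; tri>)
open import Relation.Binary.PropositionalEquality using (_≡_)

-- Exchange matrix of a quiver on n vertices: B i j = b_{ij}
Matrix : ℕ → Set
Matrix n = Fin n → Fin n → ℤ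

sgn : ℤ → ℤ
sgn x with <-cmp x (+ 0)
... | tri< _ _ _ = - (+ 1)
... | tri≈ _ _ _ = + 0
... | tri> _ _ _ = + 1

pos : ℤ → ℤ
pos x = x ⊔ + 0

μ : ∀ {n} → Fin n → Matrix n → Matrix n
μ k B i j =
  if does (i ≟ k) ∨ does (j ≟ k)
  then - B i j
  else B i j + sgn (B i k) * pos (B i k * B k j)

-- apply a sequence of mutations (first element of the list applied last)
μs : ∀ {n} → List (Fin n) → Matrix n → Matrix n
μs ks B = foldr μ B ks

_≐_ : ∀ {n} → Matrix n → Matrix n → Set
B ≐ C = ∀ i j → B i j ≡ C i j

-- Quiver Q on mutable vertices v_1..v_n (indices suc i) with an extra
-- frozen vertex q (index zero), with b_i arrows from v_i to q.
extend : ∀ {n} → Matrix n → (Fin n → ℤ) → Matrix (suc n)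
extend B b zero    zero    = + 0
extend B b (suc i) zero    = b i
extend B b zero    (suc j) = - b j
extend B b (suc i) (suc j) = B i j

-- A quiver with frozen vertex zero and mutable vertices suc i has finite
-- mutation class: the set of matrices reachable by mutations at mutable
-- vertices is finite (contained in some finite list).
MutationFiniteFrozen : ∀ {n} → Matrix (suc n) → Set
MutationFiniteFrozen {n} B =
  ∃ λ (L : List (Matrix (suc n))) →
    ∀ (ks : List (Fin n)) → Any (λ C → C ≐ μs (map suc ks) B) L

Admissible : ∀ {n} → Matrix n → (Fin n → ℤ) → Set
Admissible B b = ¬ (∀ i → b i ≡ + 0) × MutationFiniteFrozen (extend B b)

count : ∀ {n} → Fin n → Fin n → List (Fin n × Fin n) → ℕ
count i j [] = 0
count i j ((u , v) ∷ as) =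
  if does (i ≟ u) Data.Bool.∧ does (j ≟ v) then suc (count i j as) else count i j as

fromArrows : ∀ {n} → List (Fin n × Fin n) → Matrix n
fromArrows as i j = + count i j as Data.Integer.- + count j i as

orient : ∀ {n} → Bool → Fin n × Fin n → Fin n × Fin n
orient true  (u , v) = (u , v)
orient false (u , v) = (v , u)

vA vB vX1 vX2 vX3 vY1 vY2 vZ1 vZ2 : Fin 9
vA  = Data.Fin.fromℕ< {0} (Data.Nat.s≤s Data.Nat.z≤n)
vB  = Data.Fin.fromℕ< {1} (Data.Nat.Properties.m≤n+m 2 7)
vX1 = Data.Fin.fromℕ< {2} (Data.Nat.Properties.m≤n+m 3 6)
vX2 = Data.Fin.fromℕ< {3} (Data.Nat.Properties.m≤n+m 4 5)
vX3 = Data.Fin.fromℕ< {4} (Data.Nat.Properties.m≤n+m 5 4)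
vY1 = Data.Fin.fromℕ< {5} (Data.Nat.Properties.m≤n+m 6 3)
vY2 = Data.Fin.fromℕ< {6} (Data.Nat.Properties.m≤n+m 7 2)
vZ1 = Data.Fin.fromℕ< {7} (Data.Nat.Properties.m≤n+m 8 1)
vZ2 = Data.Fin.fromℕ< {8} (Data.Nat.Properties.m≤n+m 9 0)

-- The quiver E_7^{(1,1)}; the orientations of the four pendant-path
-- arrows are given by o (any orientation allowed).
E711 : (Fin 4 → Bool) → Matrix 9
E711 o = fromArrows
  ( (vA , vB) ∷ (vA , vB)
  ∷ (vB , vX1) ∷ (vB , vX2) ∷ (vB , vX3)
  ∷ (vX1 , vA) ∷ (vX2 , vA) ∷ (vX3 , vA)
  ∷ orient (o zero) (vX1 , vY1)
  ∷ orient (o (suc zero)) (vY1 , vY2)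
  ∷ orient (o (suc (suc zero))) (vX3 , vZ1)
  ∷ orient (o (suc (suc (suc zero)))) (vZ1 , vZ2)
  ∷ [])

{-# OPTIONS --safe #-}
-- Finiteness of the mutation class bounds the frozen column b. Alternating
-- mutations at the ends of a double arrow u ⇒ v make b grow linearly unless
-- b u + b v = 0 ≤ b v, so these relations hold for every double arrow in every
-- quiver of the class.
--
-- The class of E_7^(1,1) contains a wheel: a hub with four incoming and four
-- outgoing spokes and a rim of eight vertices. Mutating at an incoming spoke u₁,
-- the hub, and the other incoming spokes u₂, u₃, u₄ produces a double arrow from the
-- hub to u₁. If the value c at the hub is ≤ 0, its relation reads u₁ = u₂ + u₃ + u₄
-- whatever the signs of the uᵢ. The four such relations give uᵢ = 0, and then
-- the value c at the sink of the double arrow must be ≥ 0. Dually c ≥ 0 kills the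
-- outgoing spokes and gives c ≤ 0. Hence b = 0 on the wheel, and mutation
-- reflects b = 0.
module Submission where

open import Defs
open import Data.Bool using (Bool; true; false; if_then_else_; _∨_)
open import Data.Bool.Properties using (∨-identityʳ)
open import Data.Empty using (⊥)
open import Data.Fin using (Fin; zero; suc; _≟_)
open import Data.Fin.Patterns
open import Data.Fin.Properties using (all?)
open import Data.Integer using (ℤ; +_; -[1+_]; -_; _+_; _*_; _<_; _≤_; ∣_∣; +≤+)
import Data.Integer.Properties as ℤ
open import Data.Integer.Tactic.RingSolver using (solve-∀)
open import Data.List using (List; []; _∷_; _++_; map; foldr; foldl; reverse)
open import Data.List.Properties using (reverse-map; reverse-foldr)
open import Data.List.Relation.Unary.Any using (Any; here; there)
open import Data.Nat as ℕ using (ℕ; zero; suc; z≤n)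
import Data.Nat.Properties as ℕ
open import Data.Product using (_×_; _,_; ∃; proj₁; proj₂)
open import Data.Sum using ([_,_]′)
open import Data.Vec using (Vec; []; _∷_; lookup; tabulate)
open import Data.Vec.Properties using (lookup∘tabulate)
open import Function using (_∘_; flip)
open import Relation.Binary.PropositionalEquality using (_≡_; _≢_; refl; sym; trans; cong; cong₂; subst; module ≡-Reasoning)
open import Relation.Nullary using (Dec; does; yes; no; ¬_; contradiction)
open import Relation.Nullary.Decidable using (dec-false; dec-true; map′; toWitness; _×-dec_)

-- Mutation of matrices as an involution.

μ-cong : ∀ {n} (k : Fin n) {B C : Matrix n} → B ≐ C → μ k B ≐ μ k C
μ-cong k eq i j rewrite eq i j | eq i k | eq k j = refl

pos-nonNeg : ∀ {x} → + 0 ≤ x → pos x ≡ x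
pos-nonNeg = ℤ.i≥j⇒i⊔j≡i

pos-nonPos : ∀ {x} → x ≤ + 0 → pos x ≡ + 0
pos-nonPos = ℤ.i≤j⇒i⊔j≡j

pos-split : ∀ x → pos x ≡ x + pos (- x)
pos-split (+ zero)  = refl
pos-split (+ suc n) = cong +_ (trans (ℕ.⊔-identityʳ (suc n)) (sym (ℕ.+-identityʳ (suc n))))
pos-split -[1+ n ]  = sym (ℤ.+-inverseˡ (+ suc n))

sgn-neg : ∀ x → sgn (- x) ≡ - sgn x
sgn-neg (+ zero)  = refl
sgn-neg (+ suc n) = refl
sgn-neg -[1+ n ]  = refl

μ-column : ∀ {n} (k : Fin n) B i → μ k B i k ≡ - B i k
μ-column k B i rewrite dec-true (k ≟ k) refl with does (i ≟ k)
... | true  = refl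
... | false = refl

μ-row : ∀ {n} (k : Fin n) B j → μ k B k j ≡ - B k j
μ-row k B j rewrite dec-true (k ≟ k) refl = refl

-- The first mutation negates row and column `k`, so the product `B i k * B k j` survives while the
-- sign in front of it flips; the two corrections cancel.
μ-involutive : ∀ {n} (k : Fin n) B → μ k (μ k B) ≐ B
μ-involutive k B i j with does (i ≟ k) ∨ does (j ≟ k)
... | true  = ℤ.neg-involutive (B i j)
... | false rewrite μ-column k B i | μ-row k B j | sgn-neg (B i k) =
  trans (cong (λ z → B i j + s * pos z + - s * pos (- x * - y)) (sym (neg*neg x y)))
        (cancel (B i j) s (pos (- x * - y)))
  where
  x = B i k
  y = B k j
  s = sgn x
  neg*neg : ∀ x y → - x * - y ≡ x * y
  neg*neg = solve-∀
  cancel : ∀ a s p → a + s * p + - s * p ≡ a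
  cancel = solve-∀

-- Equal to x + sgn m * pos (m * y); the separate clauses for a single arrow
-- make iterated mutations of a symbolic frozen column reduce to short terms.
shift : ℤ → ℤ → ℤ → ℤ
shift (+ 0)      y x = x
shift (+ 1)      y x = x + pos y
shift -[1+ 0 ]   y x = x + - pos (- y)
shift m          y x = x + sgn m * pos (m * y)

shift-correct : ∀ m y x → x + sgn m * pos (m * y) ≡ shift m y x
shift-correct (+ 0)           y x = ℤ.+-identityʳ x
shift-correct (+ 1)           y x = cong (_+_ x) (trans (ℤ.*-identityˡ _) (cong pos (ℤ.*-identityˡ y)))
shift-correct (+ suc (suc _)) y x = refl
shift-correct -[1+ 0 ]        y x = cong (_+_ x) (trans (ℤ.-1*i≡-i _) (cong (λ z → - pos z) (ℤ.-1*i≡-i y)))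
shift-correct -[1+ suc _ ]    y x = refl

-- The effect of μ k on the frozen column b; it does not involve the frozen row.
ν : ∀ {n} → Fin n → Matrix n → (Fin n → ℤ) → Fin n → ℤ
ν k B b i = if does (i ≟ k) then - b i else shift (B i k) (b k) (b i)

-- The head of the list acts first, opposite to `μs`; a bound then passes to the mutated pair by
-- prepending `k`.
νs : ∀ {n} → List (Fin n) → Matrix n → (Fin n → ℤ) → Fin n → ℤ
νs []       B b = b
νs (k ∷ ks) B b = νs ks (μ k B) (ν k B b)

Bounded : ∀ {n} → ℕ → Matrix n → (Fin n → ℤ) → Set
Bounded N B b = ∀ ks i → ∣ νs ks B b i ∣ ℕ.≤ N

Bounded-ν : ∀ {n N} k {B : Matrix n} {b} → Bounded N B b → Bounded N (μ k B) (ν k B b)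
Bounded-ν k bd ks = bd (k ∷ ks)

Bounded-νs : ∀ {n N} ks {B : Matrix n} {b} → Bounded N B b → Bounded N (foldl (flip μ) B ks) (νs ks B b)
Bounded-νs []       bd = bd
Bounded-νs (k ∷ ks) bd = Bounded-νs ks (Bounded-ν k bd)

νs-cong : ∀ {n} ks {B C : Matrix n} {b c} → B ≐ C → (∀ i → b i ≡ c i) → ∀ i → νs ks B b i ≡ νs ks C c i
νs-cong []       B≐C b≐c = b≐c
νs-cong (k ∷ ks) {B} {C} {b} {c} B≐C b≐c = νs-cong ks (μ-cong k B≐C) eq
  where
  eq : ∀ i → ν k B b i ≡ ν k C c i
  eq i rewrite B≐C i k | b≐c i | b≐c k = refl

frozen-column : ∀ {n} ks {M : Matrix (suc n)} {B b} →
  (∀ i j → M (suc i) (suc j) ≡ B i j) → (∀ i → M (suc i) zero ≡ b i) →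
  ∀ i → foldl (flip μ) M (map suc ks) (suc i) zero ≡ νs ks B b i
frozen-column []       block column = column
frozen-column (k ∷ ks) {M} {B} {b} block column = frozen-column ks block′ column′
  where
  block′ : ∀ i j → μ (suc k) M (suc i) (suc j) ≡ μ k B i j
  block′ i j rewrite block i j | block i k | block k j = refl
  column′ : ∀ i → μ (suc k) M (suc i) zero ≡ ν k B b i
  column′ i rewrite ∨-identityʳ (does (i ≟ k)) | column i | block i k | column k
    with does (i ≟ k)
  ... | true  = refl
  ... | false = shift-correct (B i k) (b k) (b i)

-- From a finite mutation class to a bounded frozen column.

bound-Fin : ∀ {n} (f : Fin n → ℕ) → ∃ λ N → ∀ i → f i ℕ.≤ N
bound-Fin {zero}  f = 0 , λ ()
bound-Fin {suc n} f with bound-Fin (f ∘ suc)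
... | N , le = f zero ℕ.⊔ N , λ
  { zero    → ℕ.m≤m⊔n (f zero) N
  ; (suc i) → ℕ.≤-trans (le i) (ℕ.m≤n⊔m (f zero) N) }

-- The bound is chosen before `P`, so one `N` serves all mutation sequences.
bound-List : ∀ {A : Set} {n} (f : A → Fin n → ℕ) (xs : List A) →
  ∃ λ N → ∀ {P : A → Set} → Any P xs → ∃ λ x → P x × ∀ i → f x i ℕ.≤ N
bound-List f []       = 0 , λ ()
bound-List f (x ∷ xs) with bound-Fin (f x) | bound-List f xs
... | N , le | N′ , le′ = N ℕ.⊔ N′ , λ
  { (here p)  → x , p , λ i → ℕ.≤-trans (le i) (ℕ.m≤m⊔n N N′)
  ; (there p) → let (y , q , le″) = le′ p in y , q , λ i → ℕ.≤-trans (le″ i) (ℕ.m≤n⊔m N N′) }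

finite⇒bounded : ∀ {n} {B : Matrix n} {b} → MutationFiniteFrozen (extend B b) → ∃ λ N → Bounded N B b
finite⇒bounded {B = B} {b} (L , reach) with bound-List (λ C i → ∣ C (suc i) zero ∣) L
... | N , le = N , λ ks i →
  -- `μs` applies the last entry of its list first and `νs` the head, hence the reversal.
  let (C , eq , le′) = le (reach (reverse ks))
      C≡ : C (suc i) zero ≡ νs ks B b i
      C≡ = begin
        C (suc i) zero                                          ≡⟨ eq (suc i) zero ⟩
        foldr μ (extend B b) (map suc (reverse ks)) (suc i) zero  ≡⟨ cong (λ ws → foldr μ (extend B b) ws (suc i) zero) (reverse-map suc ks) ⟩
        foldr μ (extend B b) (reverse (map suc ks)) (suc i) zero  ≡⟨ cong (λ M → M (suc i) zero) (reverse-foldr μ (extend B b) (map suc ks)) ⟩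
        foldl (flip μ) (extend B b) (map suc ks) (suc i) zero     ≡⟨ frozen-column ks (λ _ _ → refl) (λ _ → refl) i ⟩
        νs ks B b i ∎
  in subst (λ z → ∣ z ∣ ℕ.≤ N) C≡ (le′ i)
  where open ≡-Reasoning

-- Rigidity and its invariance under mutation.

Rigid : ∀ {n} → Matrix n → Set
Rigid B = ∀ {N b} → Bounded N B b → ∀ i → b i ≡ + 0

Rigid-≐ : ∀ {n} {B C : Matrix n} → B ≐ C → Rigid B → Rigid C
Rigid-≐ B≐C rigid {N} bd = rigid λ ks i →
  subst (λ z → ∣ z ∣ ℕ.≤ N) (sym (νs-cong ks B≐C (λ _ → refl) i)) (bd ks i)

shift-zero : ∀ m x → shift m (+ 0) x ≡ x
shift-zero m x = trans (sym (shift-correct m (+ 0) x))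
  (trans (cong (λ z → x + sgn m * pos z) (ℤ.*-zeroʳ m))
         (trans (cong (_+_ x) (ℤ.*-zeroʳ (sgn m))) (ℤ.+-identityʳ x)))

-- The value at `k` is only negated, so it was zero already; then every other value was shifted by
-- zero.
ν-reflects-0 : ∀ {n} k (B : Matrix n) b → (∀ i → ν k B b i ≡ + 0) → ∀ i → b i ≡ + 0
ν-reflects-0 k B b eq i with does (i ≟ k) | eq i
... | true  | -bi≡0 = ℤ.neg-injective -bi≡0
... | false | shift≡0 = trans (sym (shift-zero (B i k) (b i)))
                              (trans (cong (λ y → shift (B i k) y (b i)) (sym bk≡0)) shift≡0)
  where
  bk≡0 : b k ≡ + 0
  bk≡0 with does (k ≟ k) | dec-true (k ≟ k) refl | eq k
  ... | true | _ | -bk≡0 = ℤ.neg-injective -bk≡0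

-- Mutating once more at `k` returns to `B` with a column under the same bound; that column
-- vanishes, hence so does the original one.
Rigid-μ : ∀ {n} k {B : Matrix n} → Rigid B → Rigid (μ k B)
Rigid-μ k {B} rigid {b = b} bd = ν-reflects-0 k (μ k B) b
  (Rigid-≐ (λ i j → sym (μ-involutive k B i j)) rigid (Bounded-ν k bd))

Rigid-μs : ∀ {n} ks {B : Matrix n} → Rigid B → Rigid (μs ks B)
Rigid-μs []       rigid = rigid
Rigid-μs (k ∷ ks) rigid = Rigid-μ k (Rigid-μs ks rigid)

-- Growth along a double arrow.

ν-at : ∀ {n} k (B : Matrix n) b → ν k B b k ≡ - b k
ν-at k B b rewrite dec-true (k ≟ k) refl = refl

ν-away : ∀ {n} {i k} (B : Matrix n) b → i ≢ k → ν k B b i ≡ shift (B i k) (b k) (b i)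
ν-away {i = i} {k} B b i≢k rewrite dec-false (i ≟ k) i≢k = refl

-- A `Matrix` carries no skew-symmetry, so both entries are recorded.
record DoubleArrow {n} (B : Matrix n) (u v : Fin n) : Set where
  constructor doubleArrow
  field
    distinct : u ≢ v
    forward  : B u v ≡ + 2
    backward : B v u ≡ - (+ 2)

DoubleArrow-source : ∀ {n} {B : Matrix n} {u v} → DoubleArrow B u v → DoubleArrow (μ u B) v u
DoubleArrow-source {B = B} {u} {v} (doubleArrow u≢v uv vu) =
  doubleArrow (u≢v ∘ sym) (trans (μ-column u B v) (cong -_ vu)) (trans (μ-row u B v) (cong -_ uv))

DoubleArrow-sink : ∀ {n} {B : Matrix n} {u v} → DoubleArrow B u v → DoubleArrow (μ v B) v u
DoubleArrow-sink {B = B} {u} {v} (doubleArrow u≢v uv vu) =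
  doubleArrow (u≢v ∘ sym) (trans (μ-row v B u) (cong -_ vu)) (trans (μ-column v B u) (cong -_ uv))

ν-source : ∀ {n} {B : Matrix n} {u v} b → DoubleArrow B u v →
  ν u B b v ≡ b v + - pos (- (+ 2 * b u))
ν-source {B = B} {u} {v} b (doubleArrow u≢v _ vu) = begin
  ν u B b v                              ≡⟨ ν-away B b (u≢v ∘ sym) ⟩
  shift (B v u) (b u) (b v)              ≡⟨ cong (λ m → shift m (b u) (b v)) vu ⟩
  b v + -[1+ 0 ] * pos (-[1+ 1 ] * b u)  ≡⟨ cong (_+_ (b v)) (ℤ.-1*i≡-i _) ⟩
  b v + - pos (-[1+ 1 ] * b u)           ≡⟨ cong (λ z → b v + - pos z) (sym (ℤ.neg-distribˡ-* (+ 2) (b u))) ⟩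
  b v + - pos (- (+ 2 * b u))            ∎
  where open ≡-Reasoning

ν-sink : ∀ {n} {B : Matrix n} {u v} b → DoubleArrow B u v →
  ν v B b u ≡ b u + pos (+ 2 * b v)
ν-sink {B = B} {u} {v} b (doubleArrow u≢v uv _) = begin
  ν v B b u                        ≡⟨ ν-away B b u≢v ⟩
  shift (B u v) (b v) (b u)        ≡⟨ cong (λ m → shift m (b v) (b u)) uv ⟩
  b u + + 1 * pos (+ 2 * b v)      ≡⟨ cong (_+_ (b u)) (ℤ.*-identityˡ _) ⟩
  b u + pos (+ 2 * b v)            ∎
  where open ≡-Reasoning

double-nonNeg : ∀ {x} → + 0 ≤ x → + 0 ≤ + 2 * x
double-nonNeg = ℤ.*-monoˡ-≤-nonNeg (+ 2)

double-nonPos : ∀ {x} → x ≤ + 0 → + 2 * x ≤ + 0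
double-nonPos = ℤ.*-monoˡ-≤-nonNeg (+ 2)

∣i∣≤N⇒0≤N+i : ∀ i {N} → ∣ i ∣ ℕ.≤ N → + 0 ≤ + N + i
∣i∣≤N⇒0≤N+i (+ n)    le = +≤+ z≤n
∣i∣≤N⇒0≤N+i -[1+ n ] le = subst (+ 0 ≤_) (sym (ℤ.⊖-≥ le)) (+≤+ z≤n)

<-suc : ∀ {x y n} → x < y → y < + suc n → x < + n
<-suc x<y y<1+n = ℤ.<-≤-trans x<y (ℤ.i<j⇒i≤pred[j] y<1+n)

-- Mutating at a source with b u < 0 makes v the source of a new double arrow:
-- b u + b v is preserved and the value at the source drops by ∣ b u + b v ∣.
source-drift : ∀ {n N} m {B : Matrix n} {b u v} → DoubleArrow B u v → Bounded N B b →
  b u < + 0 → b u + b v < + 0 → ¬ (+ N + b u < + m)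
source-drift zero    {b = b} {u} d bd u<0 s<0 lt = ℤ.<⇒≱ lt (∣i∣≤N⇒0≤N+i (b u) (bd [] u))
source-drift {N = N} (suc m) {B} {b} {u} {v} d bd u<0 s<0 lt =
  source-drift m (DoubleArrow-source d) (Bounded-ν u bd)
    (subst (_< + 0) (sym v′) (ℤ.+-mono-< s<0 u<0))
    (subst (_< + 0) (sym s′) s<0)
    (<-suc (subst (λ z → + N + z < + N + b u) (sym v′) (ℤ.+-monoʳ-< (+ N) smaller)) lt)
  where
  v′ : ν u B b v ≡ b u + b v + b u
  v′ = trans (ν-source b d) (trans
    (cong (λ z → b v + - z) (pos-nonNeg (ℤ.neg-mono-≤ (double-nonPos (ℤ.<⇒≤ u<0)))))
    (eq (b u) (b v)))
    where
    eq : ∀ p q → q + - (- (+ 2 * p)) ≡ p + q + p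
    eq = solve-∀
  s′ : ν u B b v + ν u B b u ≡ b u + b v
  s′ = trans (cong₂ _+_ v′ (ν-at u B b)) (eq (b u) (b v))
    where
    eq : ∀ p q → p + q + p + - p ≡ p + q
    eq = solve-∀
  smaller : b u + b v + b u < b u
  smaller = subst (b u + b v + b u <_) (ℤ.+-identityˡ (b u)) (ℤ.+-monoˡ-< (b u) s<0)

sink-drift : ∀ {n N} m {B : Matrix n} {b u v} → DoubleArrow B u v → Bounded N B b →
  + 0 < b v → + 0 < b u + b v → ¬ (+ N + - b v < + m)
sink-drift zero {b = b} {v = v} d bd 0<v 0<s lt =
  ℤ.<⇒≱ lt (∣i∣≤N⇒0≤N+i (- b v) (subst (ℕ._≤ _) (sym (ℤ.∣-i∣≡∣i∣ (b v))) (bd [] v)))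
sink-drift {N = N} (suc m) {B} {b} {u} {v} d bd 0<v 0<s lt =
  sink-drift m (DoubleArrow-sink d) (Bounded-ν v bd)
    (subst (+ 0 <_) (sym u′) (ℤ.+-mono-< 0<s 0<v))
    (subst (+ 0 <_) (sym s′) 0<s)
    (<-suc (subst (λ z → + N + - z < + N + - b v) (sym u′) (ℤ.+-monoʳ-< (+ N) (ℤ.neg-mono-< larger))) lt)
  where
  u′ : ν v B b u ≡ b u + b v + b v
  u′ = trans (ν-sink b d) (trans
    (cong (_+_ (b u)) (pos-nonNeg (double-nonNeg (ℤ.<⇒≤ 0<v))))
    (eq (b u) (b v)))
    where
    eq : ∀ p q → p + + 2 * q ≡ p + q + q
    eq = solve-∀
  s′ : ν v B b v + ν v B b u ≡ b u + b v
  s′ = trans (cong₂ _+_ (ν-at v B b) u′) (eq (b u) (b v))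
    where
    eq : ∀ p q → - q + (p + q + q) ≡ p + q
    eq = solve-∀
  larger : b v < b u + b v + b v
  larger = subst (_< b u + b v + b v) (ℤ.+-identityˡ (b v)) (ℤ.+-monoˡ-< (b v) 0<s)

source-sum-nonNeg : ∀ {n N} {B : Matrix n} {b u v} → DoubleArrow B u v → Bounded N B b →
  b u < + 0 → + 0 ≤ b u + b v
source-sum-nonNeg {N = N} {b = b} {u} d bd u<0 = ℤ.≮⇒≥ λ s<0 →
  -- As `b u` is negative, `N` itself lies strictly above `+ N + b u` and can start the counter.
  source-drift N d bd u<0 s<0 (subst (+ N + b u <_) (ℤ.+-identityʳ (+ N)) (ℤ.+-monoʳ-< (+ N) u<0))

sink-sum-nonPos : ∀ {n N} {B : Matrix n} {b u v} → DoubleArrow B u v → Bounded N B b →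
  + 0 < b v → b u + b v ≤ + 0
sink-sum-nonPos {N = N} {b = b} {v = v} d bd 0<v = ℤ.≮⇒≥ λ 0<s →
  sink-drift N d bd 0<v 0<s (subst (+ N + - b v <_) (ℤ.+-identityʳ (+ N)) (ℤ.+-monoʳ-< (+ N) (ℤ.neg-mono-< 0<v)))

sink-nonNeg : ∀ {n N} {B : Matrix n} {b u v} → DoubleArrow B u v → Bounded N B b → + 0 ≤ b v
sink-nonNeg {B = B} {b} {u} {v} d bd = ℤ.≮⇒≥ λ v<0 → case (b u ℤ.<? + 0) v<0
  where
  case : Dec (b u < + 0) → b v < + 0 → ⊥
  case (yes u<0) v<0 = ℤ.<⇒≱ (ℤ.+-mono-< u<0 v<0) (source-sum-nonNeg d bd u<0)
  case (no u≮0)  v<0 = ℤ.<⇒≱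
    (subst (_< + 0) (sym (cong₂ _+_ v′ (ν-at u B b))) (ℤ.+-mono-<-≤ v<0 (ℤ.neg-mono-≤ 0≤u)))
    (source-sum-nonNeg (DoubleArrow-source d) (Bounded-ν u bd) (subst (_< + 0) (sym v′) v<0))
    where
    0≤u = ℤ.≮⇒≥ u≮0
    v′ : ν u B b v ≡ b v
    v′ = trans (ν-source b d) (trans
      (cong (λ z → b v + - z) (pos-nonPos (ℤ.neg-mono-≤ (double-nonNeg 0≤u))))
      (ℤ.+-identityʳ (b v)))

source-nonPos : ∀ {n N} {B : Matrix n} {b u v} → DoubleArrow B u v → Bounded N B b → b u ≤ + 0
source-nonPos {B = B} {b} {u} {v} d bd = ℤ.≮⇒≥ λ 0<u → case (+ 0 ℤ.<? b v) 0<u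
  where
  case : Dec (+ 0 < b v) → + 0 < b u → ⊥
  case (yes 0<v) 0<u = ℤ.<⇒≱ (ℤ.+-mono-< 0<u 0<v) (sink-sum-nonPos d bd 0<v)
  case (no 0≮v)  0<u = ℤ.<⇒≱
    (subst (+ 0 <_) (sym (cong₂ _+_ (ν-at v B b) u′)) (ℤ.+-mono-≤-< (ℤ.neg-mono-≤ v≤0) 0<u))
    (sink-sum-nonPos (DoubleArrow-sink d) (Bounded-ν v bd) (subst (+ 0 <_) (sym u′) 0<u))
    where
    v≤0 = ℤ.≮⇒≥ 0≮v
    u′ : ν v B b u ≡ b u
    u′ = trans (ν-sink b d) (trans
      (cong (_+_ (b u)) (pos-nonPos (double-nonPos v≤0)))
      (ℤ.+-identityʳ (b u)))

double-arrow-sum : ∀ {n N} {B : Matrix n} {b u v} → DoubleArrow B u v → Bounded N B b → b u + b v ≡ + 0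
double-arrow-sum {b = b} {u} {v} d bd with b u ℤ.<? + 0 | + 0 ℤ.<? b v
... | yes u<0 | yes 0<v = ℤ.≤-antisym (sink-sum-nonPos d bd 0<v) (source-sum-nonNeg d bd u<0)
... | yes u<0 | no 0≮v  = contradiction (source-sum-nonNeg d bd u<0) (ℤ.<⇒≱ (ℤ.+-mono-<-≤ u<0 (ℤ.≮⇒≥ 0≮v)))
... | no u≮0  | yes 0<v = contradiction (sink-sum-nonPos d bd 0<v) (ℤ.<⇒≱ (ℤ.+-mono-≤-< (ℤ.≮⇒≥ u≮0) 0<v))
... | no u≮0  | no 0≮v  = cong₂ _+_ (ℤ.≤-antisym (source-nonPos d bd) (ℤ.≮⇒≥ u≮0))
                                    (ℤ.≤-antisym (ℤ.≮⇒≥ 0≮v) (sink-nonNeg d bd))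

-- Hub and rim values after the spoke mutations.

nonPos-split : ∀ {x} → x ≤ + 0 → - pos (- x) ≡ x
nonPos-split {x} x≤0 = trans (cong -_ (pos-nonNeg (ℤ.neg-mono-≤ x≤0))) (ℤ.neg-involutive x)

pos-difference : ∀ x → pos x + - pos (- x) ≡ x
pos-difference x = trans (cong (λ z → z + - pos (- x)) (pos-split x)) (eq x (pos (- x)))
  where
  eq : ∀ x z → x + z + - z ≡ x
  eq = solve-∀

0≤pos : ∀ x → + 0 ≤ pos x
0≤pos x = ℤ.i≤j⊔i x (+ 0)

-- The values at the hub and at the spoke of u₁ after mutating at u₁, the hub,
-- u₂, u₃, u₄, when all four spokes point to the hub.
module InSpokes (c u₁ u₂ u₃ u₄ : ℤ) where
  c′ = c + - pos (- u₁)

  push : ℤ → ℤ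
  push u = u + pos c′

  hub rim : ℤ
  hub = - c′ + pos (push u₂) + pos (push u₃) + pos (push u₄)
  rim = - u₁ + - pos (- c′) + - pos (- push u₂) + - pos (- push u₃) + - pos (- push u₄)

  module _ (c≤0 : c ≤ + 0) where
    c′≤0 : c′ ≤ + 0
    c′≤0 = ℤ.+-mono-≤ c≤0 (ℤ.neg-mono-≤ (0≤pos (- u₁)))

    push≡ : ∀ u → push u ≡ u
    push≡ u = trans (cong (_+_ u) (pos-nonPos c′≤0)) (ℤ.+-identityʳ u)

    -- Each of `u₂`, `u₃`, `u₄` gives its positive part to `hub` and minus its negative part to
    -- `rim`; together these are the value itself, whatever its sign. The two contributions of `c′`
    -- cancel because `c′` is nonpositive.
    hub+rim : hub + rim ≡ - u₁ + u₂ + u₃ + u₄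
    hub+rim = trans
      (regroup c′ (pos (push u₂)) (pos (push u₃)) (pos (push u₄)) u₁ (- pos (- c′))
               (- pos (- push u₂)) (- pos (- push u₃)) (- pos (- push u₄)))
      (cong₂ _+_ (cong₂ _+_ (cong₂ _+_
        (trans (cong (λ z → - u₁ + (- c′ + z)) (nonPos-split c′≤0)) (cancel u₁ c′))
        (part u₂)) (part u₃)) (part u₄))
      where
      regroup : ∀ c a₂ a₃ a₄ u z z₂ z₃ z₄ →
        - c + a₂ + a₃ + a₄ + (- u + z + z₂ + z₃ + z₄) ≡ - u + (- c + z) + (a₂ + z₂) + (a₃ + z₃) + (a₄ + z₄)
      regroup = solve-∀
      cancel : ∀ u c → - u + (- c + c) ≡ - u
      cancel = solve-∀
      part : ∀ u → pos (push u) + - pos (- push u) ≡ u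
      part u = trans (pos-difference (push u)) (push≡ u)

    -- The rim vertex is the sink of the double arrow, so its nonnegative value forces `c` to be
    -- nonnegative.
    rim-central : u₁ ≡ + 0 → u₂ ≡ + 0 → u₃ ≡ + 0 → u₄ ≡ + 0 → rim ≡ c
    rim-central refl refl refl refl
      rewrite nonPos-split c′≤0 | push≡ (+ 0) = eq c
      where
      eq : ∀ c → + 0 + (c + + 0) + + 0 + + 0 + + 0 ≡ c
      eq = solve-∀

-- The same for spokes pointing away from the hub.
module OutSpokes (c w₁ w₂ w₃ w₄ : ℤ) where
  c′ = c + pos w₁

  pull : ℤ → ℤ
  pull w = w + - pos (- c′)

  hub rim : ℤ
  hub = - c′ + - pos (- pull w₂) + - pos (- pull w₃) + - pos (- pull w₄)
  rim = - w₁ + pos c′ + pos (pull w₂) + pos (pull w₃) + pos (pull w₄)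

  module _ (0≤c : + 0 ≤ c) where
    0≤c′ : + 0 ≤ c′
    0≤c′ = ℤ.+-mono-≤ 0≤c (0≤pos w₁)

    pull≡ : ∀ w → pull w ≡ w
    pull≡ w = trans (cong (λ z → w + - z) (pos-nonPos (ℤ.neg-mono-≤ 0≤c′))) (ℤ.+-identityʳ w)

    rim+hub : rim + hub ≡ - w₁ + w₂ + w₃ + w₄
    rim+hub = trans
      (regroup c′ (pos (pull w₂)) (pos (pull w₃)) (pos (pull w₄)) w₁ (pos c′)
               (- pos (- pull w₂)) (- pos (- pull w₃)) (- pos (- pull w₄)))
      (cong₂ _+_ (cong₂ _+_ (cong₂ _+_
        (trans (cong (λ z → - w₁ + (z + - c′)) (pos-nonNeg 0≤c′)) (cancel w₁ c′))
        (part w₂)) (part w₃)) (part w₄))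
      where
      regroup : ∀ c a₂ a₃ a₄ w z z₂ z₃ z₄ →
        - w + z + a₂ + a₃ + a₄ + (- c + z₂ + z₃ + z₄) ≡ - w + (z + - c) + (a₂ + z₂) + (a₃ + z₃) + (a₄ + z₄)
      regroup = solve-∀
      cancel : ∀ w c → - w + (c + - c) ≡ - w
      cancel = solve-∀
      part : ∀ w → pos (pull w) + - pos (- pull w) ≡ w
      part w = trans (pos-difference (pull w)) (pull≡ w)

    -- Here the hub is the sink, so the nonnegativity of `- c` bounds `c` from above.
    hub-central : w₁ ≡ + 0 → w₂ ≡ + 0 → w₃ ≡ + 0 → w₄ ≡ + 0 → hub ≡ - c
    hub-central refl refl refl refl rewrite pull≡ (+ 0) = eq c
      where
      eq : ∀ c → - (c + + 0) + + 0 + + 0 + + 0 ≡ - c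
      eq = solve-∀

-- With J the all-ones matrix of size four, the coefficient matrix J - 2I squares to 4I; applying it
-- to the relations isolates four times each unknown.
balanced⇒0 : ∀ {x y z t} →
  - x + y + z + t ≡ + 0 → - y + x + z + t ≡ + 0 → - z + x + y + t ≡ + 0 → - t + x + y + z ≡ + 0 →
  x ≡ + 0 × y ≡ + 0 × z ≡ + 0 × t ≡ + 0
balanced⇒0 {x} {y} {z} {t} ex ey ez et =
    quarter (trans (eqx x y z t) (cong₂ _+_ (cong₂ _+_ (cong₂ _+_ (cong -_ ex) ey) ez) et))
  , quarter (trans (eqy x y z t) (cong₂ _+_ (cong₂ _+_ (cong₂ _+_ ex (cong -_ ey)) ez) et))
  , quarter (trans (eqz x y z t) (cong₂ _+_ (cong₂ _+_ (cong₂ _+_ ex ey) (cong -_ ez)) et))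
  , quarter (trans (eqt x y z t) (cong₂ _+_ (cong₂ _+_ (cong₂ _+_ ex ey) ez) (cong -_ et)))
  where
  quarter : ∀ {i} → + 4 * i ≡ + 0 → i ≡ + 0
  quarter {i} = ℤ.*-cancelˡ-≡ (+ 4) i (+ 0)
  eqx : ∀ x y z t → + 4 * x ≡
    - (- x + y + z + t) + (- y + x + z + t) + (- z + x + y + t) + (- t + x + y + z)
  eqx = solve-∀
  eqy : ∀ x y z t → + 4 * y ≡
    (- x + y + z + t) + - (- y + x + z + t) + (- z + x + y + t) + (- t + x + y + z)
  eqy = solve-∀
  eqz : ∀ x y z t → + 4 * z ≡
    (- x + y + z + t) + (- y + x + z + t) + - (- z + x + y + t) + (- t + x + y + z)
  eqz = solve-∀
  eqt : ∀ x y z t → + 4 * t ≡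
    (- x + y + z + t) + (- y + x + z + t) + (- z + x + y + t) + - (- t + x + y + z)
  eqt = solve-∀

-- Rigidity of the wheel.

-- The hub is vA; the labelling is chosen so that wheel→straight below ends
-- exactly in E711, without a permutation of the vertices.
wheel : Matrix 9
wheel = fromArrows
  ( (vB , vA) ∷ (vX1 , vA) ∷ (vX2 , vA) ∷ (vX3 , vA)
  ∷ (vA , vY1) ∷ (vA , vY2) ∷ (vA , vZ1) ∷ (vA , vZ2)
  ∷ (vY1 , vX2) ∷ (vY1 , vX3) ∷ (vY2 , vB) ∷ (vY2 , vX1)
  ∷ (vZ1 , vX1) ∷ (vZ1 , vX2) ∷ (vZ2 , vB) ∷ (vZ2 , vX3)
  ∷ [])

-- For incoming spokes, the first two mutations leave one arrow from `k₁` to the hub and a path from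
-- the hub through each other spoke to `k₁`. The last three mutations add three arrows against that
-- one, a net double arrow. For outgoing spokes all directions are reversed.
spokeMutations : Fin 9 → Fin 9 → Fin 9 → Fin 9 → List (Fin 9)
spokeMutations k₁ k₂ k₃ k₄ = k₁ ∷ vA ∷ k₂ ∷ k₃ ∷ k₄ ∷ []

-- The parameters `x` and `y` let the closed forms of `InSpokes` and `OutSpokes` be matched with the
-- mutated column by evaluation.
spoke-relations : ∀ {N b} → Bounded N wheel b → ∀ k₁ k₂ k₃ k₄ {u v x y} →
  DoubleArrow (foldl (flip μ) wheel (spokeMutations k₁ k₂ k₃ k₄)) u v →
  νs (spokeMutations k₁ k₂ k₃ k₄) wheel b u ≡ x → νs (spokeMutations k₁ k₂ k₃ k₄) wheel b v ≡ y →
  x + y ≡ + 0 × + 0 ≤ y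
spoke-relations {b = b} bd k₁ k₂ k₃ k₄ d refl refl = double-arrow-sum d bd′ , sink-nonNeg d bd′
  where
  bd′ = Bounded-νs (spokeMutations k₁ k₂ k₃ k₄) {wheel} {b} bd

module _ {N b} (bd : Bounded N wheel b) where

  in-spokes-vanish : b vA ≤ + 0 →
    b vA ≡ + 0 × b vB ≡ + 0 × b vX1 ≡ + 0 × b vX2 ≡ + 0 × b vX3 ≡ + 0
  in-spokes-vanish c≤0 = ℤ.≤-antisym c≤0 0≤sink , vanish
    where
    c = b vA
    module B = InSpokes c (b vB) (b vX1) (b vX2) (b vX3)
    rel-B : B.hub + B.rim ≡ + 0 × + 0 ≤ B.rim
    rel-B = spoke-relations bd vB vX1 vX2 vX3 {vA} {vB} {B.hub} {B.rim} (doubleArrow (λ ()) refl refl) refl refl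
    module X1 = InSpokes c (b vX1) (b vB) (b vX2) (b vX3)
    rel-X1 : X1.hub + X1.rim ≡ + 0 × + 0 ≤ X1.rim
    rel-X1 = spoke-relations bd vX1 vB vX2 vX3 {vA} {vX1} {X1.hub} {X1.rim} (doubleArrow (λ ()) refl refl) refl refl
    module X2 = InSpokes c (b vX2) (b vB) (b vX1) (b vX3)
    rel-X2 : X2.hub + X2.rim ≡ + 0 × + 0 ≤ X2.rim
    rel-X2 = spoke-relations bd vX2 vB vX1 vX3 {vA} {vX2} {X2.hub} {X2.rim} (doubleArrow (λ ()) refl refl) refl refl
    module X3 = InSpokes c (b vX3) (b vB) (b vX1) (b vX2)
    rel-X3 : X3.hub + X3.rim ≡ + 0 × + 0 ≤ X3.rim
    rel-X3 = spoke-relations bd vX3 vB vX1 vX2 {vA} {vX3} {X3.hub} {X3.rim} (doubleArrow (λ ()) refl refl) refl refl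
    vanish : b vB ≡ + 0 × b vX1 ≡ + 0 × b vX2 ≡ + 0 × b vX3 ≡ + 0
    vanish = balanced⇒0 {b vB} {b vX1} {b vX2} {b vX3}
      (trans (sym (B.hub+rim c≤0)) (proj₁ rel-B))
      (trans (sym (X1.hub+rim c≤0)) (proj₁ rel-X1))
      (trans (sym (X2.hub+rim c≤0)) (proj₁ rel-X2))
      (trans (sym (X3.hub+rim c≤0)) (proj₁ rel-X3))
    0≤sink = subst (+ 0 ≤_) (let (e₁ , e₂ , e₃ , e₄) = vanish in B.rim-central c≤0 e₁ e₂ e₃ e₄) (proj₂ rel-B)

  out-spokes-vanish : + 0 ≤ b vA →
    b vA ≡ + 0 × b vY1 ≡ + 0 × b vY2 ≡ + 0 × b vZ1 ≡ + 0 × b vZ2 ≡ + 0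
  out-spokes-vanish 0≤c = ℤ.≤-antisym (ℤ.neg-cancel-≤ 0≤sink) 0≤c , vanish
    where
    c = b vA
    module Y1 = OutSpokes c (b vY1) (b vY2) (b vZ1) (b vZ2)
    rel-Y1 : Y1.rim + Y1.hub ≡ + 0 × + 0 ≤ Y1.hub
    rel-Y1 = spoke-relations bd vY1 vY2 vZ1 vZ2 {vY1} {vA} {Y1.rim} {Y1.hub} (doubleArrow (λ ()) refl refl) refl refl
    module Y2 = OutSpokes c (b vY2) (b vY1) (b vZ1) (b vZ2)
    rel-Y2 : Y2.rim + Y2.hub ≡ + 0 × + 0 ≤ Y2.hub
    rel-Y2 = spoke-relations bd vY2 vY1 vZ1 vZ2 {vY2} {vA} {Y2.rim} {Y2.hub} (doubleArrow (λ ()) refl refl) refl refl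
    module Z1 = OutSpokes c (b vZ1) (b vY1) (b vY2) (b vZ2)
    rel-Z1 : Z1.rim + Z1.hub ≡ + 0 × + 0 ≤ Z1.hub
    rel-Z1 = spoke-relations bd vZ1 vY1 vY2 vZ2 {vZ1} {vA} {Z1.rim} {Z1.hub} (doubleArrow (λ ()) refl refl) refl refl
    module Z2 = OutSpokes c (b vZ2) (b vY1) (b vY2) (b vZ1)
    rel-Z2 : Z2.rim + Z2.hub ≡ + 0 × + 0 ≤ Z2.hub
    rel-Z2 = spoke-relations bd vZ2 vY1 vY2 vZ1 {vZ2} {vA} {Z2.rim} {Z2.hub} (doubleArrow (λ ()) refl refl) refl refl
    vanish : b vY1 ≡ + 0 × b vY2 ≡ + 0 × b vZ1 ≡ + 0 × b vZ2 ≡ + 0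
    vanish = balanced⇒0 {b vY1} {b vY2} {b vZ1} {b vZ2}
      (trans (sym (Y1.rim+hub 0≤c)) (proj₁ rel-Y1))
      (trans (sym (Y2.rim+hub 0≤c)) (proj₁ rel-Y2))
      (trans (sym (Z1.rim+hub 0≤c)) (proj₁ rel-Z1))
      (trans (sym (Z2.rim+hub 0≤c)) (proj₁ rel-Z2))
    0≤sink = subst (+ 0 ≤_) (let (e₁ , e₂ , e₃ , e₄) = vanish in Y1.hub-central 0≤c e₁ e₂ e₃ e₄) (proj₂ rel-Y1)

wheel-rigid : Rigid wheel
wheel-rigid {N} {b} bd = vanish
  where
  -- Either sign of the hub value makes it zero, after which both halves apply.
  c≡0 : b vA ≡ + 0
  c≡0 = [ proj₁ ∘ in-spokes-vanish {N} {b} bd , proj₁ ∘ out-spokes-vanish {N} {b} bd ]′ (ℤ.≤-total (b vA) (+ 0))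

  ins  = in-spokes-vanish {N} {b} bd (ℤ.≤-reflexive c≡0)
  outs = out-spokes-vanish {N} {b} bd (ℤ.≤-reflexive (sym c≡0))

  vanish : ∀ i → b i ≡ + 0
  vanish 0F = c≡0
  vanish 1F = let (_ , B≡0 , _) = ins in B≡0
  vanish 2F = let (_ , _ , X1≡0 , _) = ins in X1≡0
  vanish 3F = let (_ , _ , _ , X2≡0 , _) = ins in X2≡0
  vanish 4F = let (_ , _ , _ , _ , X3≡0) = ins in X3≡0
  vanish 5F = let (_ , Y1≡0 , _) = outs in Y1≡0
  vanish 6F = let (_ , _ , Y2≡0 , _) = outs in Y2≡0
  vanish 7F = let (_ , _ , _ , Z1≡0 , _) = outs in Z1≡0
  vanish 8F = let (_ , _ , _ , _ , Z2≡0) = outs in Z2≡0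

-- From the wheel to every orientation of the pendant paths.

-- Evaluating μs directly recomputes every entry exponentially often; the
-- tables share the entries of each intermediate matrix.
Table : Set
Table = Vec (Vec ℤ 9) 9

entry : Table → Matrix 9
entry T i j = lookup (lookup T i) j

table : Matrix 9 → Table
table B = tabulate λ i → tabulate (B i)

entry-table : ∀ B → entry (table B) ≐ B
entry-table B i j =
  trans (cong (λ row → lookup row j) (lookup∘tabulate (λ i → tabulate (B i)) i))
        (lookup∘tabulate (B i) j)

μTable : Fin 9 → Table → Table
μTable k T = table (μ k (entry T))

μTables : List (Fin 9) → Matrix 9 → Matrix 9
μTables ks B = entry (foldr μTable (table B) ks)

μTables-correct : ∀ ks B → μTables ks B ≐ μs ks B
μTables-correct []       B = entry-table B
μTables-correct (k ∷ ks) B i j =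
  trans (entry-table (μ k (μTables ks B)) i j) (μ-cong k (μTables-correct ks B) i j)

_≐?_ : ∀ {n} (B C : Matrix n) → Dec (B ≐ C)
B ≐? C = all? λ i → all? λ j → B i j ℤ.≟ C i j

all-Bool? : {P : Bool → Set} → (∀ b → Dec (P b)) → Dec (∀ b → P b)
all-Bool? P? = map′ (λ { (t , f) true → t ; (t , f) false → f }) (λ p → p true , p false)
                    (P? true ×-dec P? false)

pendants : Bool → Bool → Bool → Bool → Fin 4 → Bool
pendants p q r s = lookup (p ∷ q ∷ r ∷ s ∷ [])

straight : Matrix 9
straight = E711 (pendants true true true true)

-- Read from the end, this begins with `spokeMutations vB vX1 vX2 vX3`, which creates the double
-- arrow from `vA` to `vB`; `vY1` and `vZ1` complete the passage.
wheel→straight : List (Fin 9)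
wheel→straight = vZ1 ∷ vY1 ∷ vX3 ∷ vX2 ∷ vX1 ∷ vA ∷ vB ∷ []

wheel~straight : μTables wheel→straight wheel ≐ straight
wheel~straight = toWitness {a? = μTables wheel→straight wheel ≐? straight} _

-- Sink and source mutations turning the path x → y₁ → y₂ into the other orientations.
legMutations : Fin 9 → Fin 9 → Bool → Bool → List (Fin 9)
legMutations y₁ y₂ true  true  = []
legMutations y₁ y₂ true  false = y₂ ∷ []
legMutations y₁ y₂ false true  = y₁ ∷ y₂ ∷ []
legMutations y₁ y₂ false false = y₂ ∷ y₁ ∷ y₂ ∷ []

pendantMutations : Bool → Bool → Bool → Bool → List (Fin 9)
pendantMutations p q r s = legMutations vY1 vY2 p q ++ legMutations vZ1 vZ2 r s

straight~oriented : ∀ p q r s → μTables (pendantMutations p q r s) straight ≐ E711 (pendants p q r s)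
straight~oriented = toWitness
  {a? = all-Bool? λ p → all-Bool? λ q → all-Bool? λ r → all-Bool? λ s →
        μTables (pendantMutations p q r s) straight ≐? E711 (pendants p q r s)} _

Rigid-μTables : ∀ ks {B C} → μTables ks B ≐ C → Rigid B → Rigid C
Rigid-μTables ks {B} eq rigid =
  Rigid-≐ (λ i j → trans (sym (μTables-correct ks B i j)) (eq i j)) (Rigid-μs ks rigid)

-- `E711` reads `o` only at four literal indices, so `E711 o` equals `E711 (pendants p q r s)` by
-- computation, and the sixteen decided cases cover every `o`.
E711-rigid : ∀ o → Rigid (E711 o)
E711-rigid o = Rigid-μTables (pendantMutations p q r s) {straight} {E711 (pendants p q r s)}
  (straight~oriented p q r s)
  (Rigid-μTables wheel→straight {wheel} {straight} wheel~straight wheel-rigid)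
  where
  p = o 0F
  q = o 1F
  r = o 2F
  s = o 3F

theorem5p2 : (o : Fin 4 → Bool) (ks : List (Fin 9)) (b : Fin 9 → ℤ) →
    ¬ Admissible (μs ks (E711 o)) b
theorem5p2 o ks b (b≢0 , finite) =
  b≢0 (Rigid-μs ks (E711-rigid o) (proj₂ (finite⇒bounded finite)))
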